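{- Let $Q$ be the quiver with vertices $1,2,3,4$ and single arrows $1\to2$, $1\to3$, $1\to4$, $2\to4$, $4\to3$, $3\to2$. Then $Q$ does not have any admissible quasi-Cartan companion, and hence $Q$ is not mutation-acyclic.
   Context: A quiver is a finite directed multigraph with no loops and no oriented 2-cycles; for a quiver on vertices $1,\dots,n$, $B=(b_{ij})$ is the skew-symmetric matrix with $b_{ij}$ equal to the number of arrows $i\to j$ minus the number of arrows $j\to i$. A quasi-Cartan companion of $Q$ is a symmetric integer matrix $A=(a_{ij})$ with $a_{ii}=2$ and $|a_{ij}|=|b_{ij}|$ for $i\ne j$. A cycle in $Q$ is an induced subquiver whose vertices can be labelled by $\mathbb{Z}/k\mathbb{Z}$ so that the only pairs of adjacent vertices are $\{i,i+1\}$, $i\in\mathbb{Z}/k\mathbb{Z}$. $A$ is admissible if for every cycle $Z$ of $Q$: if $Z$ is an oriented cycle, the number of edges $\{i,j\}$ of $Z$ with $a_{ij}>0$ is odd, and if $Z$ is non-oriented, this number is even. Mutation $\mu_k$: for every path $i\to k\to j$ add an arrow $i\to j$, reverse all arrows at $k$, delete a maximal collection of oriented 2-cycles. $Q$ is mutation-acyclic if some quiver obtained from $Q$ by a sequence of mutations has no oriented cycles. -}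

module Defs where

open import Data.Nat as ℕ using (ℕ; zero; suc; _%_)
open import Data.Nat.DivMod using (_mod_)
open import Data.Integer as ℤ using (ℤ; +_; -_; _+_; _-_; _*_; _⊔_; _<_; ∣_∣; 0ℤ)
open import Data.Integer.Properties using () renaming (_<?_ to _<ℤ?_)
open import Data.Fin using (Fin; zero; suc; toℕ)
open import Data.Fin.Properties using () renaming (_≟_ to _≟F_)
open import Data.List using (List; []; _∷_; map; allFin; foldl)
open import Data.Nat.ListAction using (sum)
open import Data.Bool using (if_then_else_)
open import Data.Product using (Σ; _×_; ∃; ∃-syntax)
open import Data.Sum using (_⊎_)
open import Relation.Nullary using (¬_; Dec; yes; no)
open import Relation.Nullary.Decidable using (⌊_⌋)
open import Relation.Binary.PropositionalEquality using (_≡_; _≢_)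
open import Function.Definitions using (Injective)

-- An exchange matrix of a quiver on vertices Fin n:
-- B i j = #(arrows i → j) − #(arrows j → i).
Mat : ℕ → Set
Mat n = Fin n → Fin n → ℤ

-- A quiver (no loops, no oriented 2-cycles) on Fin n is the same as a
-- skew-symmetric integer matrix.
SkewSymmetric : ∀ {n} → Mat n → Set
SkewSymmetric B = ∀ i j → B i j ≡ - B j i

fromArrows : ∀ {n} → (Fin n → Fin n → ℕ) → Mat n
fromArrows a i j = + a i j - + a j i

IsQuasiCartanCompanion : ∀ {n} → Mat n → Mat n → Set
IsQuasiCartanCompanion B A =
  (∀ i j → A i j ≡ A j i) ×
  (∀ i → A i i ≡ + 2) ×
  (∀ i j → i ≢ j → ∣ A i j ∣ ≡ ∣ B i j ∣)

next : ∀ {k} → Fin (suc k) → Fin (suc k)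
next {k} i = suc (toℕ i) mod (suc k)

record Cycle {n} (B : Mat n) : Set where
  field
    m     : ℕ
    v     : Fin (suc (suc (suc m))) → Fin n
    inj   : Injective _≡_ _≡_ v
    adj   : ∀ i → B (v i) (v (next i)) ≢ 0ℤ
    noadj : ∀ i j → i ≢ j → j ≢ next i → i ≢ next j → B (v i) (v j) ≡ 0ℤ

open Cycle public

Oriented : ∀ {n} {B : Mat n} → Cycle B → Set
Oriented {B = B} Z =
  (∀ i → 0ℤ < B (v Z i) (v Z (next i))) ⊎ (∀ i → B (v Z i) (v Z (next i)) < 0ℤ)

positiveEdges : ∀ {n} {B : Mat n} → Mat n → Cycle B → ℕ
positiveEdges A Z =
  sum (map (λ i → if ⌊ 0ℤ <ℤ? A (v Z i) (v Z (next i)) ⌋ then 1 else 0)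
           (allFin (suc (suc (suc (m Z))))))

Odd Even : ℕ → Set
Odd x = x % 2 ≡ 1
Even x = x % 2 ≡ 0

IsAdmissible : ∀ {n} → Mat n → Mat n → Set
IsAdmissible B A = (Z : Cycle B) →
  (Oriented Z → Odd (positiveEdges A Z)) × (¬ Oriented Z → Even (positiveEdges A Z))

HasAdmissibleQuasiCartanCompanion : ∀ {n} → Mat n → Set
HasAdmissibleQuasiCartanCompanion B =
  ∃[ A ] (IsQuasiCartanCompanion B A × IsAdmissible B A)

-- Quiver mutation at k, in matrix form:
-- b'ij = −bij if i = k or j = k; otherwise
-- b'ij = bij + [bik]₊[bkj]₊ − [−bik]₊[−bkj]₊
-- (add arrows i→j for paths i→k→j, arrows j→i for paths j→k→i,
--  cancel 2-cycles).
pos : ℤ → ℤ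
pos x = x ⊔ 0ℤ

mutate : ∀ {n} → Fin n → Mat n → Mat n
mutate k B i j with i ≟F k | j ≟F k
... | yes _ | _ = - B i j
... | no _ | yes _ = - B i j
... | no _ | no _ =
  B i j + pos (B i k) * pos (B k j) - pos (- B i k) * pos (- B k j)

mutateSeq : ∀ {n} → List (Fin n) → Mat n → Mat n
mutateSeq ks B = foldl (λ C k → mutate k C) B ks

HasOrientedCycle : ∀ {n} → Mat n → Set
HasOrientedCycle {n} B =
  ∃[ m ] Σ (Fin (suc m) → Fin n) λ w → ∀ i → 0ℤ < B (w i) (w (next i))

Acyclic : ∀ {n} → Mat n → Set
Acyclic B = ¬ HasOrientedCycle B

MutationAcyclic : ∀ {n} → Mat n → Set
MutationAcyclic B = ∃[ ks ] Acyclic (mutateSeq ks B)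

-- The quiver of Theorem 4.11, vertices 1,2,3,4 ↦ 0,1,2,3:
-- arrows 1→2, 1→3, 1→4, 2→4, 4→3, 3→2.
arrowsQ : Fin 4 → Fin 4 → ℕ
arrowsQ zero (suc zero) = 1
arrowsQ zero (suc (suc zero)) = 1
arrowsQ zero (suc (suc (suc zero))) = 1
arrowsQ (suc zero) (suc (suc (suc zero))) = 1
arrowsQ (suc (suc (suc zero))) (suc (suc zero)) = 1
arrowsQ (suc (suc zero)) (suc zero) = 1
arrowsQ _ _ = 0

BQ : Mat 4
BQ = fromArrows arrowsQ

{-# OPTIONS --safe #-}
module Submission where

-- Each edge of Q lies in two of its four triangles, and exactly one triangle is oriented; so
-- the numbers of positive edges would have an even sum, with exactly one odd summand.
--
-- Up to three small seeds, relabelling and reversal of all arrows, the quivers in the mutation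
-- class of Q are strong tournaments with weights
--   w : 0 → 1,  u : 1 → 2,  m : 2 → 3,  v : 3 → 0,  p : 3 → 1,  q : 0 → 2,
-- where u, v > 0 and w, m, p, q ≥ 0.  Two invariants govern them: a Markov-type polynomial of
-- value 7 and the Pfaffian of B, of value ±3.  Mutation at 0 or 1 always leads to another strong
-- tournament, but mutation at 2 (symmetrically 3) could produce an acyclic quiver if p ≥ u m.
-- Writing p = u m + s, the two equations leave only finitely many solutions of this kind, and
-- these mutate back to the seeds.

open import Defs
open import Data.Empty using (⊥; ⊥-elim)
open import Data.Bool using (if_then_else_)
open import Data.Fin using (Fin; #_)
open import Data.Fin.Patterns using (0F; 1F; 2F; 3F)
open import Data.Fin.Permutation
  using (Permutation′; permutation; _⟨$⟩ʳ_; _⟨$⟩ˡ_; id; inverseʳ)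
open import Data.Fin.Properties using (all?) renaming (_≟_ to _≟F_)
open import Data.List using ([]; _∷_)
open import Data.Nat as ℕ using (ℕ; _%_)
open import Data.Nat.DivMod using (%-distribˡ-+; m*n%n≡0)
import Data.Nat.Properties as ℕₚ
import Data.Nat.Tactic.RingSolver as ℕ-Solver
open import Data.Product using (_×_; _,_; proj₁; proj₂)
open import Data.Sum using (_⊎_; inj₁; inj₂; [_,_]′)
open import Data.Vec using (Vec; []; _∷_; lookup)
open import Function.Bundles using (module Injection)
open import Function.Properties.Inverse using (↔⇒↣)
open import Relation.Binary.PropositionalEquality
open import Relation.Nullary using (¬_; Dec; yes; no)
open import Relation.Nullary.Decidable
  using (⌊_⌋; ¬?; _⊎-dec_; _→-dec_; True; False; toWitness; toWitnessFalse; from-yes)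

-- Diophantine equations over the natural numbers.

module ℕ-Equations where
  open import Data.Nat
  open import Data.Nat.Properties
  open import Data.Nat.DivMod using (%-distribˡ-*; m%n<n)
  open import Data.Nat.Divisibility using (divides)
  open import Data.Nat.Primality using (prime?; prime⇒irreducible)
  open import Data.Nat.Tactic.RingSolver using (solve-∀)
  open import Relation.Nullary.Decidable using (_×-dec_)

  -- Modulo 5 the equation reads (x + y)² ≡ 2, and 2 is not a square.
  x²+y²+3≢3xy : ∀ x y → x * x + y * y + 3 ≢ 3 * (x * y)
  x²+y²+3≢3xy x y eq = nonresidue (x + y) (trans (cong (_% 5) square) (m*n%n≡0 (x * y) 5))
    where
    nonresidue : ∀ n → (n * n + 3) % 5 ≢ 0
    nonresidue n h = from-yes (allUpTo? (λ r → ¬? (((r * r) % 5 + 3) % 5 ≟ 0)) 5) (m%n<n n 5)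
      (trans (cong (λ z → (z + 3) % 5) (sym (%-distribˡ-* n n 5)))
        (trans (sym (%-distribˡ-+ (n * n) 3 5)) h))

    expand : ∀ x y → (x + y) * (x + y) + 3 ≡ (x * x + y * y + 3) + 2 * (x * y)
    expand = solve-∀

    collect : ∀ z → 3 * z + 2 * z ≡ z * 5
    collect = solve-∀

    square : (x + y) * (x + y) + 3 ≡ x * y * 5
    square = trans (expand x y) (trans (cong (_+ 2 * (x * y)) eq) (collect (x * y)))

  xy≤x²+y² : ∀ x y → x * y ≤ x * x + y * y
  xy≤x²+y² x y with ≤-total x y
  ... | inj₁ x≤y = ≤-trans (*-monoˡ-≤ y x≤y) (m≤n+m (y * y) (x * x))
  ... | inj₂ y≤x = ≤-trans (*-monoʳ-≤ x y≤x) (m≤m+n (x * x) (y * y))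

  -- Since 3 is prime, (u, r) is (3, 1) or (1, 3). In the first case m² + q² + 10 = 7 + m q
  -- contradicts m q ≤ m² + q²; the second is m² + q² + 3 = 3 m q, excluded modulo 5.
  no-decoupled-solution : ∀ u r m q → u * r ≡ 3 →
    m * m + q * q + r * r + u * u ≢ 7 + r * (m * q)
  no-decoupled-solution u r m q ur≡3 eq
    with prime⇒irreducible (from-yes (prime? 3)) (divides u (sym ur≡3))
  ... | inj₁ refl rewrite *-identityʳ u | ur≡3 = <-irrefl refl (begin-strict
    7 + m * q               ≤⟨ +-monoʳ-≤ 7 (xy≤x²+y² m q) ⟩
    7 + (m * m + q * q)     <⟨ +-monoˡ-< (m * m + q * q) {7} {10} (from-yes (7 <? 10)) ⟩
    10 + (m * m + q * q)    ≡⟨ +-comm 10 _ ⟩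
    m * m + q * q + 10      ≡⟨ +-assoc (m * m + q * q) 1 9 ⟨
    m * m + q * q + 1 + 9   ≡⟨ eq ⟩
    7 + (m * q + 0)         ≡⟨ cong (7 +_) (+-identityʳ (m * q)) ⟩
    7 + m * q               ∎)
    where open ≤-Reasoning
  ... | inj₂ refl with *-cancelʳ-≡ u 1 3 ur≡3
  ... | refl = x²+y²+3≢3xy m q (+-cancelʳ-≡ 7 _ _ (begin
    m * m + q * q + 3 + 7      ≡⟨ +-assoc (m * m + q * q) 3 7 ⟩
    m * m + q * q + 10         ≡⟨ +-assoc (m * m + q * q) 9 1 ⟨
    m * m + q * q + 9 + 1      ≡⟨ eq ⟩
    7 + 3 * (m * q)            ≡⟨ +-comm 7 _ ⟩
    3 * (m * q) + 7            ∎))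
    where open ≡-Reasoning

  n²≤7⇒n<3 : ∀ {n} → n * n ≤ 7 → n < 3
  n²≤7⇒n<3 {n} n²≤7 = ≰⇒> λ 3≤n → <⇒≱ (from-yes (7 <? 9)) (≤-trans (*-mono-≤ 3≤n 3≤n) n²≤7)

  ut<3 : ∀ {u} → u < 3 → ∀ {t} → t < 3 → u * u + t * t ≤ 7 → u * t < 3
  ut<3 = from-yes (allUpTo? (λ u → allUpTo? (λ t →
    (u * u + t * t ≤? 7) →-dec (u * t <? 3)) 3) 3)

  -- Twice w m + q s is at most the sum of the four squares, so w m + q s ≤ 3; equality would force
  -- w = m, q = s and w² + q² = 3, which is impossible. On this range a finite check suffices.
  wm+qs<3 : ∀ {w} → w < 3 → ∀ {m} → m < 3 → ∀ {q} → q < 3 → ∀ {s} → s < 3 →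
    w * w + (s * s + (m * m + q * q)) ≤ 6 → w * m + q * s < 3
  wm+qs<3 = from-yes (allUpTo? (λ w → allUpTo? (λ m → allUpTo? (λ q → allUpTo? (λ s →
    (w * w + (s * s + (m * m + q * q)) ≤? 6) →-dec (w * m + q * s <? 3)) 3) 3) 3) 3)

  -- The equations of a State with p = u m + s and v = m q + t; k collects the mixed terms.
  definite : ∀ w u s m q t k → 1 ≤ u →
    u * u + (t * t + (w * w + (s * s + (m * m + (q * q + k))))) ≡ 7 →
    ¬ (w * m + q * s ≡ u * t + 3 ⊎ w * m + q * s + 3 ≡ u * t)
  definite w u s m q t k 1≤u eq = λ where
      (inj₁ pf) → <⇒≱ (wm+qs<3 (head w h₃) (head m h₅) (head q h₆) (head s h₄) sum≤6)
                       (≤-trans (m≤n+m 3 (u * t)) (≤-reflexive (sym pf)))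
      (inj₂ pf) → <⇒≱ (ut<3 (head u h₁) (head t h₂)
                         (m+n≤o⇒m≤o (u * u + t * t)
                           (≤-reflexive (trans (+-assoc (u * u) (t * t) _) eq))))
                       (≤-trans (m≤n+m 3 (w * m + q * s)) (≤-reflexive pf))
    where
    head : ∀ n {k} → n * n + k ≤ 7 → n < 3
    head n h = n²≤7⇒n<3 (m+n≤o⇒m≤o (n * n) h)
    h₁ = ≤-reflexive eq
    h₂ = m+n≤o⇒n≤o (u * u) h₁
    h₃ = m+n≤o⇒n≤o (t * t) h₂
    h₄ = m+n≤o⇒n≤o (w * w) h₃
    h₅ = m+n≤o⇒n≤o (s * s) h₄
    h₆ = m+n≤o⇒n≤o (m * m) h₅
    open ≤-Reasoning
    -- As u ≥ 1, the square u² uses up at least 1 of the total 7. The bound 7 would be too weak for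
    -- `wm+qs<3`.
    sum≤6 : w * w + (s * s + (m * m + q * q)) ≤ 6
    sum≤6 = +-cancelˡ-≤ 1 _ _ (begin
      1 + (w * w + (s * s + (m * m + q * q)))
        ≤⟨ +-mono-≤ (*-mono-≤ 1≤u 1≤u)
             (+-monoʳ-≤ (w * w) (+-monoʳ-≤ (s * s) (+-monoʳ-≤ (m * m) (m≤m+n (q * q) k)))) ⟩
      u * u + (w * w + (s * s + (m * m + (q * q + k))))
        ≤⟨ +-monoʳ-≤ (u * u) (m≤n+m _ (t * t)) ⟩
      u * u + (t * t + (w * w + (s * s + (m * m + (q * q + k)))))
        ≡⟨ eq ⟩
      7 ∎)

  -- The equations of a State with p = u m + s and m q = v + r.
  Degenerate : (w u s m q r v : ℕ) → Set
  Degenerate w u s m q r v =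
    m * m + q * q + r * r + u * u + w * w + s * s + u * m * s + w * u * q + v * w * s
      ≡ 7 + r * (m * q) × u * r + w * m + q * s ≡ 3 × m * q ≡ v + r

  Degenerate-swap : ∀ w u s m q r v → Degenerate w u s m q r v → Degenerate s u w q m r v
  Degenerate-swap w u s m q r v (eq , pf , mq) =
    trans (lhs w u s m q r v) (trans eq (cong (λ z → 7 + r * z) (*-comm m q))) ,
    trans (mid w u s m q r) pf , trans (*-comm q m) mq
    where
    lhs : ∀ w u s m q r v →
      q * q + m * m + r * r + u * u + s * s + w * w + u * q * w + s * u * m + v * s * w
      ≡ m * m + q * q + r * r + u * u + w * w + s * s + u * m * s + w * u * q + v * w * s
    lhs = solve-∀
    mid : ∀ w u s m q r → u * r + s * q + m * w ≡ u * r + w * m + q * s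
    mid = solve-∀

  n²≤7+4n⇒n<6 : ∀ {n} → n * n ≤ 7 + 4 * n → n < 6
  n²≤7+4n⇒n<6 {n} h = ≰⇒> λ 6≤n → <⇒≱ (from-yes (7 <? 12)) (+-cancelʳ-≤ (4 * n) 12 7 (begin
    2 * 6 + 4 * n  ≤⟨ +-monoˡ-≤ (4 * n) (*-monoʳ-≤ 2 6≤n) ⟩
    2 * n + 4 * n  ≡⟨ *-distribʳ-+ n 2 4 ⟨
    6 * n          ≤⟨ *-monoˡ-≤ n 6≤n ⟩
    n * n          ≤⟨ h ⟩
    7 + 4 * n      ∎))
    where open ≤-Reasoning

  Degenerate? : ∀ w u s m q r v → Dec (Degenerate w u s m q r v)
  Degenerate? w u s m q r v = (_ ≟ _) ×-dec ((_ ≟ _) ×-dec (_ ≟ _))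

  -- Exhaustive search in the box provided by `degenerate-w>0`. The unknown v is eliminated as m q -
  -- r, so that it needs no range of its own.
  degenerate-bounded : ∀ {w} → w < 3 → 1 ≤ w → ∀ {u} → u < 3 → 1 ≤ u →
    ∀ {r} → r < 3 → 1 ≤ r →
    ∀ {m} → m < 3 → ∀ {s} → s < 3 → ∀ {q} → q < 6 → 1 ≤ m * q ∸ r →
    Degenerate w u s m q r (m * q ∸ r) →
    w ≡ 1 × u ≡ 1 × s ≡ 0 × m ≡ 2 × q ≡ 1 × m * q ∸ r ≡ 1
  degenerate-bounded = from-yes
    (allUpTo? (λ w → 1 ≤? w →-dec allUpTo? (λ u → 1 ≤? u →-dec allUpTo? (λ r → 1 ≤? r →-dec
      allUpTo? (λ m → allUpTo? (λ s → allUpTo? (λ q →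
      1 ≤? m * q ∸ r →-dec (Degenerate? w u s m q r (m * q ∸ r) →-dec
      ((w ≟ 1) ×-dec ((u ≟ 1) ×-dec ((s ≟ 0) ×-dec ((m ≟ 2) ×-dec ((q ≟ 1)
        ×-dec (m * q ∸ r ≟ 1))))))))
      6) 3) 3) 3) 3) 3)

  -- From m q = v + r both m and q are positive, so u r ≥ 1 and w m ≥ 1. In u r + w m + q s = 3
  -- every product is then at most 2, which bounds all of w, u, s, m, r by 2. The first equation now
  -- gives q² ≤ 7 + r m q ≤ 7 + 4 q, hence q < 6.
  degenerate-w>0 : ∀ w u s m q r v → 1 ≤ w → 1 ≤ u → 1 ≤ r → 1 ≤ v →
    Degenerate w u s m q r v → w ≡ 1 × u ≡ 1 × s ≡ 0 × m ≡ 2 × q ≡ 1 × v ≡ 1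
  degenerate-w>0 w u s m q r v 1≤w 1≤u 1≤r 1≤v D@(eq , pf , mq≡v+r) =
    subst (λ z → w ≡ 1 × u ≡ 1 × s ≡ 0 × m ≡ 2 × q ≡ 1 × z ≡ 1) (sym v≡mq∸r)
      (degenerate-bounded w<3 1≤w u<3 1≤u r<3 1≤r m<3 s<3 q<6
        (subst (1 ≤_) v≡mq∸r 1≤v) (subst (Degenerate w u s m q r) v≡mq∸r D))
    where
    v≡mq∸r : v ≡ m * q ∸ r
    v≡mq∸r = sym (trans (cong (_∸ r) mq≡v+r) (m+n∸n≡m v r))

    1≤mq : 1 ≤ m * q
    1≤mq = ≤-trans 1≤v (≤-trans (m≤m+n v r) (≤-reflexive (sym mq≡v+r)))

    1≤m : 1 ≤ m
    1≤m = n≢0⇒n>0 λ { refl → <-irrefl refl 1≤mq }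

    1≤q : 1 ≤ q
    1≤q = n≢0⇒n>0 λ { refl → <⇒≱ 1≤mq (≤-reflexive (*-zeroʳ m)) }

    factorʳ : ∀ {a b k} → 1 ≤ b → a * b ≤ k → a ≤ k
    factorʳ {a} 1≤b h = ≤-trans (≤-trans (≤-reflexive (sym (*-identityʳ a))) (*-monoʳ-≤ a 1≤b)) h

    factorˡ : ∀ {a b k} → 1 ≤ a → a * b ≤ k → b ≤ k
    factorˡ {a} {b} 1≤a h = factorʳ {b} {a} 1≤a (≤-trans (≤-reflexive (*-comm b a)) h)

    ur+wm≤3 : u * r + w * m ≤ 3
    ur+wm≤3 = m+n≤o⇒m≤o (u * r + w * m) (≤-reflexive pf)

    wm≤2 : w * m ≤ 2
    wm≤2 = +-cancelˡ-≤ 1 _ _ (≤-trans (+-monoˡ-≤ (w * m) (*-mono-≤ 1≤u 1≤r)) ur+wm≤3)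

    ur≤2 : u * r ≤ 2
    ur≤2 = +-cancelʳ-≤ 1 _ _ (≤-trans (+-monoʳ-≤ (u * r) (*-mono-≤ 1≤w 1≤m)) ur+wm≤3)

    qs≤2 : q * s ≤ 2
    qs≤2 = +-cancelˡ-≤ 1 _ _ (≤-trans (+-monoˡ-≤ (q * s)
      (≤-trans (*-mono-≤ 1≤u 1≤r) (m≤m+n (u * r) (w * m)))) (≤-reflexive pf))

    w<3 : w < 3
    w<3 = s≤s (factorʳ {w} {m} 1≤m wm≤2)

    m<3 : m < 3
    m<3 = s≤s (factorˡ {w} {m} 1≤w wm≤2)

    u<3 : u < 3
    u<3 = s≤s (factorʳ {u} {r} 1≤r ur≤2)

    r<3 : r < 3
    r<3 = s≤s (factorˡ {u} {r} 1≤u ur≤2)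

    s<3 : s < 3
    s<3 = s≤s (factorˡ {q} {s} 1≤q qs≤2)

    split : ∀ w u s m q r v →
      m * m + q * q + r * r + u * u + w * w + s * s + u * m * s + w * u * q + v * w * s
      ≡ q * q + (m * m + r * r + u * u + w * w + s * s + u * m * s + w * u * q + v * w * s)
    split = solve-∀

    q<6 : q < 6
    q<6 = n²≤7+4n⇒n<6 (≤-trans
      (m+n≤o⇒m≤o (q * q) (≤-reflexive (trans (sym (split w u s m q r v)) eq)))
      (+-monoʳ-≤ 7 (≤-trans (≤-reflexive (sym (*-assoc r m q)))
        (*-monoˡ-≤ q (*-mono-≤ (s≤s⁻¹ r<3) (s≤s⁻¹ m<3))))))

  -- The equations are symmetric under m ↔ q, w ↔ s, so w > 0 may be assumed.
  degenerate : ∀ w u s m q r v → 1 ≤ u → 1 ≤ r → 1 ≤ v → Degenerate w u s m q r v →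
    (w ≡ 1 × u ≡ 1 × s ≡ 0 × m ≡ 2 × q ≡ 1 × v ≡ 1)
      ⊎ (w ≡ 0 × u ≡ 1 × s ≡ 1 × m ≡ 1 × q ≡ 2 × v ≡ 1)
  degenerate w u s m q r v 1≤u 1≤r 1≤v D with w ≟ 0 | s ≟ 0
  ... | no w≢0 | _ = inj₁ (degenerate-w>0 w u s m q r v (n≢0⇒n>0 w≢0) 1≤u 1≤r 1≤v D)
  ... | yes w≡0 | no s≢0 =
    let s≡1 , u≡1 , _ , q≡2 , m≡1 , v≡1 =
          degenerate-w>0 s u w q m r v (n≢0⇒n>0 s≢0) 1≤u 1≤r 1≤v (Degenerate-swap w u s m q r v D)
    in inj₂ (w≡0 , u≡1 , s≡1 , m≡1 , q≡2 , v≡1)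
  -- For w = s = 0 the second equation is u r = 3, the case of `no-decoupled-solution`.
  ... | yes refl | yes refl = ⊥-elim (uncoupled D)
    where
    drop₁ : ∀ u r q → u * r + 0 + q * 0 ≡ u * r
    drop₁ = solve-∀
    drop₂ : ∀ z u m v → z + 0 + 0 + u * m * 0 + 0 + v * 0 * 0 ≡ z
    drop₂ = solve-∀
    uncoupled : ¬ Degenerate 0 u 0 m q r v
    uncoupled (eq , pf , _) = no-decoupled-solution u r m q (trans (sym (drop₁ u r q)) pf)
      (trans (sym (drop₂ (m * m + q * q + r * r + u * u) u m v)) eq)

open ℕ-Equations

open import Data.Integer hiding (pos; suc; _%_; _⊔_; _⊓_)
open import Data.Integer.Properties hiding (_≟_)
open import Data.Integer.Properties using () renaming (_≟_ to _≟ℤ_)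
open import Data.Integer.Solver using (module +-*-Solver)
open +-*-Solver using (Polynomial; solve; _:=_; _:+_; _:*_; _:-_; :-_; con)

-- The four triangles of Q and the parity argument.

allAdjacent : (i j : Fin 3) → i ≡ j ⊎ j ≡ next i ⊎ i ≡ next j
allAdjacent = from-yes (all? {n = 3} λ i → all? {n = 3} λ j →
  (i ≟F j) ⊎-dec ((j ≟F next i) ⊎-dec (i ≟F next j)))

triangularCycle : ∀ {n} (B : Mat n) (t : Vec (Fin n) 3) →
  {True (all? λ i → all? λ j → (lookup t i ≟F lookup t j) →-dec (i ≟F j))} →
  {True (all? λ i → ¬? (B (lookup t i) (lookup t (next i)) ≟ℤ 0ℤ))} → Cycle B
triangularCycle B t {distinct} {adjacent} = record
  { m     = 0
  ; v     = lookup t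
  ; inj   = λ {i} {j} → toWitness distinct i j
  ; adj   = toWitness adjacent
  -- In a 3-cycle any two distinct vertices are consecutive, so this condition is vacuous.
  ; noadj = λ i j i≢j j≢i+1 i≢j+1 →
      ⊥-elim ([ i≢j , [ j≢i+1 , i≢j+1 ]′ ]′ (allAdjacent i j))
  }

oriented? : ∀ {n} {B : Mat n} (Z : Cycle B) → Dec (Oriented Z)
oriented? {B = B} Z =
  all? (λ i → 0ℤ <? B (v Z i) (v Z (next i))) ⊎-dec
  all? (λ i → B (v Z i) (v Z (next i)) <? 0ℤ)

noCompanion : ¬ HasAdmissibleQuasiCartanCompanion BQ
noCompanion (A , (sym-A , _) , admissible) = contra
  where
  χ : Fin 4 → Fin 4 → ℕ
  χ i j = if ⌊ 0ℤ <? A i j ⌋ then 1 else 0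

  -- `T₀` is the oriented triangle. Each of the others passes through 0 and traverses its common
  -- edge with `T₀` in the same direction as `T₀`, so symmetry of A is needed only for the edges at
  -- 0.
  T₀ T₁ T₂ T₃ : Cycle BQ
  T₀ = triangularCycle BQ (# 1 ∷ # 3 ∷ # 2 ∷ [])
  T₁ = triangularCycle BQ (# 0 ∷ # 1 ∷ # 3 ∷ [])
  T₂ = triangularCycle BQ (# 0 ∷ # 3 ∷ # 2 ∷ [])
  T₃ = triangularCycle BQ (# 0 ∷ # 2 ∷ # 1 ∷ [])

  odd : (Z : Cycle BQ) → {True (oriented? Z)} → Odd (positiveEdges A Z)
  odd Z {o} = proj₁ (admissible Z) (toWitness o)

  even : (Z : Cycle BQ) → {False (oriented? Z)} → Even (positiveEdges A Z)
  even Z {o} = proj₂ (admissible Z) (toWitnessFalse o)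

  doubled : ∀ a b c x y z →
    (a ℕ.+ (b ℕ.+ (c ℕ.+ 0))) ℕ.+ (x ℕ.+ (a ℕ.+ (y ℕ.+ 0)))
      ℕ.+ ((y ℕ.+ (b ℕ.+ (z ℕ.+ 0))) ℕ.+ (z ℕ.+ (c ℕ.+ (x ℕ.+ 0))))
    ≡ (a ℕ.+ b ℕ.+ c ℕ.+ x ℕ.+ y ℕ.+ z) ℕ.* 2
  doubled = ℕ-Solver.solve-∀

  parity : ∀ s₀ s₁ s₂ s₃ → Odd s₀ → Even s₁ → Even s₂ → Even s₃ →
    Odd (s₀ ℕ.+ s₁ ℕ.+ (s₂ ℕ.+ s₃))
  parity s₀ s₁ s₂ s₃ o e₁ e₂ e₃
    rewrite %-distribˡ-+ (s₀ ℕ.+ s₁) (s₂ ℕ.+ s₃) 2 ⦃ _ ⦄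
    | %-distribˡ-+ s₀ s₁ 2 ⦃ _ ⦄ | %-distribˡ-+ s₂ s₃ 2 ⦃ _ ⦄ | o | e₁ | e₂ | e₃ = refl

  s₀ = positiveEdges A T₀
  s₁ = positiveEdges A T₁
  s₂ = positiveEdges A T₂
  s₃ = positiveEdges A T₃

  total : ℕ
  total = χ (# 1) (# 3) ℕ.+ χ (# 3) (# 2) ℕ.+ χ (# 2) (# 1)
    ℕ.+ χ (# 0) (# 1) ℕ.+ χ (# 3) (# 0) ℕ.+ χ (# 2) (# 0)

  sum-even : s₀ ℕ.+ s₁ ℕ.+ (s₂ ℕ.+ s₃) ≡ total ℕ.* 2
  sum-even rewrite sym-A (# 0) (# 3) | sym-A (# 0) (# 2) | sym-A (# 1) (# 0) =
    doubled (χ (# 1) (# 3)) (χ (# 3) (# 2)) (χ (# 2) (# 1))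
      (χ (# 0) (# 1)) (χ (# 3) (# 0)) (χ (# 2) (# 0))

  contra : ⊥
  contra with trans (sym (parity s₀ s₁ s₂ s₃ (odd T₀) (even T₁) (even T₂) (even T₃)))
                    (trans (cong (_% 2) sum-even) (m*n%n≡0 total 2))
  ... | ()

-- Transfer of polynomial equations from the integers to the natural numbers.

infixl 6 _⊕_
infixl 7 _⊗_

-- Polynomials with natural coefficients, kept as syntax so that they can be read in both rings: the
-- invariants involve subtraction and are rearranged over the integers, and `uncast` brings the
-- result back to the natural numbers, where the bounds are proved.
data Poly (n : ℕ) : Set where
  var     : Fin n → Poly n
  lit     : ℕ → Poly n
  _⊕_ _⊗_ : Poly n → Poly n → Poly n

⟦_⟧ℕ : ∀ {n} → Poly n → Vec ℕ n → ℕ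
⟦ var i ⟧ℕ ρ = lookup ρ i
⟦ lit c ⟧ℕ ρ = c
⟦ e ⊕ f ⟧ℕ ρ = ⟦ e ⟧ℕ ρ ℕ.+ ⟦ f ⟧ℕ ρ
⟦ e ⊗ f ⟧ℕ ρ = ⟦ e ⟧ℕ ρ ℕ.* ⟦ f ⟧ℕ ρ

⟦_⟧ℤ : ∀ {n} → Poly n → Vec ℕ n → ℤ
⟦ var i ⟧ℤ ρ = + lookup ρ i
⟦ lit c ⟧ℤ ρ = + c
⟦ e ⊕ f ⟧ℤ ρ = ⟦ e ⟧ℤ ρ + ⟦ f ⟧ℤ ρ
⟦ e ⊗ f ⟧ℤ ρ = ⟦ e ⟧ℤ ρ * ⟦ f ⟧ℤ ρ

⟦⟧-cast : ∀ {n} (e : Poly n) ρ → + ⟦ e ⟧ℕ ρ ≡ ⟦ e ⟧ℤ ρ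
⟦⟧-cast (var i) ρ = refl
⟦⟧-cast (lit c) ρ = refl
⟦⟧-cast (e ⊕ f) ρ = trans (pos-+ (⟦ e ⟧ℕ ρ) (⟦ f ⟧ℕ ρ)) (cong₂ _+_ (⟦⟧-cast e ρ) (⟦⟧-cast f ρ))
⟦⟧-cast (e ⊗ f) ρ = trans (pos-* (⟦ e ⟧ℕ ρ) (⟦ f ⟧ℕ ρ)) (cong₂ _*_ (⟦⟧-cast e ρ) (⟦⟧-cast f ρ))

uncast : ∀ {n} (e f : Poly n) ρ → ⟦ e ⟧ℤ ρ ≡ ⟦ f ⟧ℤ ρ → ⟦ e ⟧ℕ ρ ≡ ⟦ f ⟧ℕ ρ
uncast e f ρ eq = +-injective (trans (⟦⟧-cast e ρ) (trans eq (sym (⟦⟧-cast f ρ))))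

-- Weights, invariants and exceptional states.

-- Besides the squares, markov has a term for each 3-cycle and for the 4-cycle 0 → 1 → 2 → 3 → 0,
-- with negative sign if the cycle is oriented.
markov pfaffian : (w u m v p q : ℤ) → ℤ
markov w u m v p q =
  w * w + u * u + m * m + v * v + p * p + q * q + w * u * q + v * w * p
    - u * m * p - v * m * q - w * u * m * v
pfaffian w u m v p q = w * m + p * q - u * v

`markov `pfaffian : ∀ {n} (w u m v p q : Polynomial n) → Polynomial n
`markov w u m v p q =
  w :* w :+ u :* u :+ m :* m :+ v :* v :+ p :* p :+ q :* q :+ w :* u :* q :+ v :* w :* p
    :- u :* m :* p :- v :* m :* q :- w :* u :* m :* v
`pfaffian w u m v p q = w :* m :+ p :* q :- u :* v

-- Positivity is demanded of u and v alone; for m and p + v w it follows from the equations. The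
-- Pfaffian is fixed only up to sign because relabelling and mutation may change its sign.
record State (w u m v p q : ℤ) : Set where
  constructor state
  field
    0≤w : 0ℤ ≤ w
    0<u : 0ℤ < u
    0≤m : 0ℤ ≤ m
    0<v : 0ℤ < v
    0≤p : 0ℤ ≤ p
    0≤q : 0ℤ ≤ q
    markov≡7    : markov w u m v p q ≡ + 7
    pfaffian≡±3 : pfaffian w u m v p q ≡ + 3 ⊎ pfaffian w u m v p q ≡ - (+ 3)

-- The states with p ≥ u m (e₁, e₂) and the state with w = 0, p < u m and v > q m (e₃).
data Exceptional : (w u m v p q : ℤ) → Set where
  e₁ : Exceptional (+ 0) (+ 1) (+ 1) (+ 1) (+ 2) (+ 2)
  e₂ : Exceptional (+ 1) (+ 1) (+ 2) (+ 1) (+ 2) (+ 1)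
  e₃ : Exceptional (+ 0) (+ 2) (+ 1) (+ 2) (+ 1) (+ 1)

flip± : ∀ {x y} → y ≡ - x → x ≡ + 3 ⊎ x ≡ - (+ 3) → y ≡ + 3 ⊎ y ≡ - (+ 3)
flip± y≡-x (inj₁ refl) = inj₂ y≡-x
flip± y≡-x (inj₂ refl) = inj₁ y≡-x

-- This is the exchange 0 ↔ 1, 2 ↔ 3 combined with reversal of all arrows, which preserves the shape
-- of the tournament.
State-mirror : ∀ {w u m v p q} → State w u m v p q → State w v m u q p
State-mirror {w} {u} {m} {v} {p} {q} (state hw hu hm hv hp hq M P) =
  state hw hv hm hu hq hp
    (trans (solve 6 (λ w u m v p q → `markov w v m u q p := `markov w u m v p q) refl w u m v p q) M)
    (subst (λ x → x ≡ + 3 ⊎ x ≡ - (+ 3))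
      (solve 6 (λ w u m v p q → `pfaffian w u m v p q := `pfaffian w v m u q p) refl w u m v p q) P)

i-j≡k⇒i≡j+k : ∀ {x y z} → x - y ≡ z → x ≡ y + z
i-j≡k⇒i≡j+k {x} {y} refl = solve 2 (λ x y → x := y :+ (x :- y)) refl x y

-- With v = m q + t the Markov polynomial becomes positive definite.
no-state-um≤p-mq≤v : ∀ w u m q s t → 0 ℕ.< u →
  let V = + m * + q + + t ; P = + u * + m + + s in
  markov (+ w) (+ u) (+ m) V P (+ q) ≡ + 7 →
  ¬ (pfaffian (+ w) (+ u) (+ m) V P (+ q) ≡ + 3 ⊎ pfaffian (+ w) (+ u) (+ m) V P (+ q) ≡ - (+ 3))
no-state-um≤p-mq≤v w u m q s t 0<u M P = definite w u s m q t k 0<u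
  (uncast (U ⊗ U ⊕ (T ⊗ T ⊕ (W ⊗ W ⊕ (S ⊗ S ⊕ (N ⊗ N ⊕ (Q ⊗ Q ⊕ K)))))) (lit 7) ρ
    (trans (solve 6 (λ w u m q s t →
        u :* u :+ (t :* t :+ (w :* w :+ (s :* s :+ (m :* m :+ (q :* q :+
          (u :* m :* s :+ w :* u :* q :+ m :* q :* (w :* s :+ t) :+ t :* w :* s))))))
          := `markov w u m (m :* q :+ t) (u :* m :+ s) q)
        refl (+ w) (+ u) (+ m) (+ q) (+ s) (+ t)) M))
  (pf P)
  where
  ρ = w ∷ u ∷ s ∷ m ∷ q ∷ t ∷ []
  W = var {6} (# 0)
  U = var {6} (# 1)
  S = var {6} (# 2)
  N = var {6} (# 3)
  Q = var {6} (# 4)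
  T = var {6} (# 5)
  K = U ⊗ N ⊗ S ⊕ W ⊗ U ⊗ Q ⊕ N ⊗ Q ⊗ (W ⊗ S ⊕ T) ⊕ T ⊗ W ⊗ S
  k = ⟦ K ⟧ℕ ρ
  pf≡ : pfaffian (+ w) (+ u) (+ m) (+ m * + q + + t) (+ u * + m + + s) (+ q)
    ≡ + w * + m + + q * + s - + u * + t
  pf≡ = solve 6 (λ w u m q s t → `pfaffian w u m (m :* q :+ t) (u :* m :+ s) q
    := w :* m :+ q :* s :- u :* t) refl (+ w) (+ u) (+ m) (+ q) (+ s) (+ t)
  pf : _ → w ℕ.* m ℕ.+ q ℕ.* s ≡ u ℕ.* t ℕ.+ 3 ⊎ w ℕ.* m ℕ.+ q ℕ.* s ℕ.+ 3 ≡ u ℕ.* t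
  pf (inj₁ P≡3) = inj₁ (uncast (W ⊗ N ⊕ Q ⊗ S) (U ⊗ T ⊕ lit 3) ρ
    (i-j≡k⇒i≡j+k {+ w * + m + + q * + s} {+ u * + t} (trans (sym pf≡) P≡3)))
  pf (inj₂ P≡-3) = inj₂ (uncast (W ⊗ N ⊕ Q ⊗ S ⊕ lit 3) (U ⊗ T) ρ
    (trans (cong (_+ + 3) (i-j≡k⇒i≡j+k {+ w * + m + + q * + s} {+ u * + t} (trans (sym pf≡) P≡-3)))
      (solve 1 (λ x → x :- con (+ 3) :+ con (+ 3) := x) refl (+ u * + t))))

-- Substituting p = u m + s and m q = v + r turns the two invariants into the system `Degenerate`,
-- whose two solutions with u, r, v > 0 are `e₂` and `e₁`.
exceptional-state-um≤p-v<mq : ∀ w u m v q s r → 0 ℕ.< u → 0 ℕ.< v → 0 ℕ.< r →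
  let P = + u * + m + + s in
  m ℕ.* q ≡ v ℕ.+ r →
  markov (+ w) (+ u) (+ m) (+ v) P (+ q) ≡ + 7 →
  pfaffian (+ w) (+ u) (+ m) (+ v) P (+ q) ≡ + 3 ⊎ pfaffian (+ w) (+ u) (+ m) (+ v) P (+ q) ≡ - (+ 3) →
  Exceptional (+ w) (+ u) (+ m) (+ v) P (+ q)
exceptional-state-um≤p-v<mq w u m v q s r 0<u 0<v 0<r mq≡v+r M P =
  conclude (degenerate w u s m q r v 0<u 0<r 0<v (eqn , pf P , mq≡v+r))
  where
  ρ = w ∷ u ∷ s ∷ m ∷ q ∷ r ∷ v ∷ []
  W = var {7} (# 0)
  U = var {7} (# 1)
  S = var {7} (# 2)
  N = var {7} (# 3)
  Q = var {7} (# 4)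
  R = var {7} (# 5)
  V = var {7} (# 6)

  -- The ring solver proves only unconditional identities, so the relation m q = v + r enters
  -- through a multiple of this vanishing difference.
  δ≡0 : + m * + q - (+ v + + r) ≡ 0ℤ
  δ≡0 = trans (cong (_- (+ v + + r)) (trans (sym (pos-* m q)) (trans (cong +_ mq≡v+r) (pos-+ v r))))
    (+-inverseʳ (+ v + + r))

  eqn : ⟦ N ⊗ N ⊕ Q ⊗ Q ⊕ R ⊗ R ⊕ U ⊗ U ⊕ W ⊗ W ⊕ S ⊗ S ⊕ U ⊗ N ⊗ S ⊕ W ⊗ U ⊗ Q ⊕ V ⊗ W ⊗ S ⟧ℕ ρ
    ≡ ⟦ lit 7 ⊕ R ⊗ (N ⊗ Q) ⟧ℕ ρ
  eqn = uncast (N ⊗ N ⊕ Q ⊗ Q ⊕ R ⊗ R ⊕ U ⊗ U ⊕ W ⊗ W ⊕ S ⊗ S ⊕ U ⊗ N ⊗ S ⊕ W ⊗ U ⊗ Q ⊕ V ⊗ W ⊗ S)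
    (lit 7 ⊕ R ⊗ (N ⊗ Q)) ρ
    (trans (solve 7 (λ w u s m q r v →
        m :* m :+ q :* q :+ r :* r :+ u :* u :+ w :* w :+ s :* s :+ u :* m :* s :+ w :* u :* q :+ v :* w :* s
        := `markov w u m v (u :* m :+ s) q :+ (r :* (m :* q) :+ (v :- r) :* (m :* q :- (v :+ r))))
        refl (+ w) (+ u) (+ s) (+ m) (+ q) (+ r) (+ v))
      (cong₂ _+_ M (trans (cong (λ z → + r * (+ m * + q) + (+ v - + r) * z) δ≡0)
        (solve 2 (λ a b → a :+ b :* con 0ℤ := a) refl (+ r * (+ m * + q)) (+ v - + r)))))

  pf≡ : ⟦ U ⊗ R ⊕ W ⊗ N ⊕ Q ⊗ S ⟧ℤ ρ ≡ pfaffian (+ w) (+ u) (+ m) (+ v) (+ u * + m + + s) (+ q)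
  pf≡ = trans (solve 7 (λ w u s m q r v →
      u :* r :+ w :* m :+ q :* s := `pfaffian w u m v (u :* m :+ s) q :- u :* (m :* q :- (v :+ r)))
      refl (+ w) (+ u) (+ s) (+ m) (+ q) (+ r) (+ v))
    (trans (cong (λ z → X - + u * z) δ≡0)
      (solve 2 (λ a b → a :- b :* con 0ℤ := a) refl X (+ u)))
    where X = pfaffian (+ w) (+ u) (+ m) (+ v) (+ u * + m + + s) (+ q)

  pf : _ → u ℕ.* r ℕ.+ w ℕ.* m ℕ.+ q ℕ.* s ≡ 3
  pf (inj₁ P≡3) = uncast (U ⊗ R ⊕ W ⊗ N ⊕ Q ⊗ S) (lit 3) ρ (trans pf≡ P≡3)
  -- The left side is a sum of products of natural numbers and cannot be -3.
  pf (inj₂ P≡-3) with trans (⟦⟧-cast (U ⊗ R ⊕ W ⊗ N ⊕ Q ⊗ S) ρ) (trans pf≡ P≡-3)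
  ... | ()

  conclude : (w ≡ 1 × u ≡ 1 × s ≡ 0 × m ≡ 2 × q ≡ 1 × v ≡ 1)
      ⊎ (w ≡ 0 × u ≡ 1 × s ≡ 1 × m ≡ 1 × q ≡ 2 × v ≡ 1) →
    Exceptional (+ w) (+ u) (+ m) (+ v) (+ u * + m + + s) (+ q)
  conclude (inj₁ (refl , refl , refl , refl , refl , refl)) = e₂
  conclude (inj₂ (refl , refl , refl , refl , refl , refl)) = e₁

-- If p ≥ u m, compare v with m q: v ≥ m q makes the Markov form definite and is impossible, while v
-- < m q leaves the degenerate solutions. Hence mutation at 2 reverses the arrows 3 → 1 outside the
-- exceptional states.
p<um-or-exceptional : ∀ {w u m v p q} → State w u m v p q → p < u * m ⊎ Exceptional w u m v p q
p<um-or-exceptional (state (+≤+ {n = w} _) (+<+ {n = u} 0<u) (+≤+ {n = m} _) (+<+ {n = v} 0<v)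
            (+≤+ {n = p} _) (+≤+ {n = q} _) M P) with p ℕ.<? u ℕ.* m
... | yes p<um = inj₁ (subst (+ p <_) (pos-* u m) (+<+ p<um))
... | no p≮um = inj₂ (subst (λ p → Exceptional (+ w) (+ u) (+ m) (+ v) p (+ q)) (sym p≡)
                  (by-v (subst (λ p → markov (+ w) (+ u) (+ m) (+ v) p (+ q) ≡ + 7) p≡ M)
                        (subst (λ p → pfaffian (+ w) (+ u) (+ m) (+ v) p (+ q) ≡ + 3
                                    ⊎ pfaffian (+ w) (+ u) (+ m) (+ v) p (+ q) ≡ - (+ 3)) p≡ P)))
  where
  s = p ℕ.∸ u ℕ.* m
  p≡ : + p ≡ + u * + m + + s
  p≡ = trans (cong +_ (sym (ℕₚ.m+[n∸m]≡n (ℕₚ.≮⇒≥ p≮um))))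
    (trans (pos-+ (u ℕ.* m) s) (cong (_+ + s) (pos-* u m)))

  by-v : markov (+ w) (+ u) (+ m) (+ v) (+ u * + m + + s) (+ q) ≡ + 7 →
    pfaffian (+ w) (+ u) (+ m) (+ v) (+ u * + m + + s) (+ q) ≡ + 3
      ⊎ pfaffian (+ w) (+ u) (+ m) (+ v) (+ u * + m + + s) (+ q) ≡ - (+ 3) →
    Exceptional (+ w) (+ u) (+ m) (+ v) (+ u * + m + + s) (+ q)
  by-v M P with v ℕ.<? m ℕ.* q
  ... | yes v<mq = exceptional-state-um≤p-v<mq w u m v q s (m ℕ.* q ℕ.∸ v) 0<u 0<v
    (ℕₚ.m<n⇒0<n∸m v<mq) (sym (ℕₚ.m+[n∸m]≡n (ℕₚ.<⇒≤ v<mq))) M P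
  ... | no v≮mq = ⊥-elim (no-state-um≤p-mq≤v w u m q s t 0<u
    (subst (λ v → markov (+ w) (+ u) (+ m) v (+ u * + m + + s) (+ q) ≡ + 7) v≡ M)
    (subst (λ v → pfaffian (+ w) (+ u) (+ m) v (+ u * + m + + s) (+ q) ≡ + 3
                ⊎ pfaffian (+ w) (+ u) (+ m) v (+ u * + m + + s) (+ q) ≡ - (+ 3)) v≡ P))
    where
    t = v ℕ.∸ m ℕ.* q
    v≡ : + v ≡ + m * + q + + t
    v≡ = trans (cong +_ (sym (ℕₚ.m+[n∸m]≡n (ℕₚ.≮⇒≥ v≮mq))))
      (trans (pos-+ (m ℕ.* q) t) (cong (_+ + t) (pos-* m q)))

-- Positivity of weights and mutation of states.

*-nonneg : ∀ {i j} → 0ℤ ≤ i → 0ℤ ≤ j → 0ℤ ≤ i * j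
*-nonneg {i} {j} (+≤+ {n = m} _) (+≤+ {n = n} _) = subst (0ℤ ≤_) (pos-* m n) (+≤+ ℕ.z≤n)

i<j⇒0<j-i : ∀ {i j} → i < j → 0ℤ < j - i
i<j⇒0<j-i {i} {j} i<j = subst (_< j - i) (+-inverseʳ i) (+-monoˡ-< (- i) i<j)

0<1+ : ∀ {n} → 0ℤ < + ℕ.suc n
0<1+ = +<+ (ℕ.s≤s ℕ.z≤n)

-- Here the Pfaffian is - u v, so u v = 3, and the Markov equation becomes the one excluded by
-- `no-decoupled-solution`.
w=p=0⇒⊥ : ∀ {u m v q} → ¬ State 0ℤ u m v 0ℤ q
w=p=0⇒⊥ (state _ (+<+ {n = u} _) (+≤+ {n = m} _) (+<+ {n = v} _) _ (+≤+ {n = q} _) M P) =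
  no-decoupled-solution u v m q (uv≡3 P)
    (uncast (N ⊗ N ⊕ Q ⊗ Q ⊕ V ⊗ V ⊕ U ⊗ U) (lit 7 ⊕ V ⊗ (N ⊗ Q)) ρ
      (trans (solve 4 (λ u m v q → m :* m :+ q :* q :+ v :* v :+ u :* u
          := `markov (con 0ℤ) u m v (con 0ℤ) q :+ v :* (m :* q)) refl (+ u) (+ m) (+ v) (+ q))
        (cong (_+ + v * (+ m * + q)) M)))
  where
  ρ = u ∷ m ∷ v ∷ q ∷ []
  U = var {4} (# 0)
  N = var {4} (# 1)
  V = var {4} (# 2)
  Q = var {4} (# 3)
  pf≡ : + u * + v ≡ - pfaffian 0ℤ (+ u) (+ m) (+ v) 0ℤ (+ q)
  pf≡ = solve 4 (λ u m v q → u :* v := :- `pfaffian (con 0ℤ) u m v (con 0ℤ) q)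
    refl (+ u) (+ m) (+ v) (+ q)
  uv≡3 : _ → u ℕ.* v ≡ 3
  uv≡3 (inj₁ P≡3) with trans (pos-* u v) (trans pf≡ (cong -_ P≡3))
  ... | ()
  uv≡3 (inj₂ P≡-3) = +-injective (trans (pos-* u v) (trans pf≡ (cong -_ P≡-3)))

-- For m = 0 the inequality p < u m would contradict p ≥ 0, and the exceptional states have m ≥ 1.
0<m : ∀ {w u m v p q} → State w u m v p q → 0ℤ < m
0<m {u = u} S with p<um-or-exceptional S
... | inj₂ e₁ = 0<1+
... | inj₂ e₂ = 0<1+
... | inj₂ e₃ = 0<1+
... | inj₁ p<um = ≤∧≢⇒< (State.0≤m S) λ { refl →
  <⇒≱ p<um (≤-trans (≤-reflexive (*-zeroʳ u)) (State.0≤p S)) }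

-- As v > 0, the sum vanishes only for p = w = 0. It is the weight of 3 → 1 after mutation at 0.
0<p+vw : ∀ {w u m v p q} → State w u m v p q → 0ℤ < p + v * w
0<p+vw {v = v} {p = p} S@(state (+≤+ {n = w} _) _ _ (+<+ {n = v′} 0<v) (+≤+ {n = p′} _) _ _ _) =
  ≤∧≢⇒< (+-mono-≤ (State.0≤p S) (*-nonneg (<⇒≤ (State.0<v S)) (State.0≤w S))) λ 0≡p+vw →
    vanish w p′ S (+-injective (trans (pos-+ p′ (v′ ℕ.* w))
      (trans (cong (λ z → + p′ + z) (pos-* v′ w)) (sym 0≡p+vw))))
  where
  vanish : ∀ w p {u m q} → State (+ w) u m (+ v′) (+ p) q → p ℕ.+ v′ ℕ.* w ≢ 0
  vanish w p S eq with ℕₚ.m+n≡0⇒m≡0 p eq | ℕₚ.m*n≡0⇒m≡0∨n≡0 v′ (ℕₚ.m+n≡0⇒n≡0 p eq)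
  ... | refl | inj₂ refl = w=p=0⇒⊥ S
  ... | refl | inj₁ refl = ℕₚ.<-irrefl refl 0<v

-- The mutated weights refer to the vertex orders 1 2 0 3, 2 0 3 1, 0 1 3 2 and 2 0 1 3.
State-mutate₀ : ∀ {w u m v p q} → State w u m v p q → m ≤ v * q →
  State u q v (p + v * w) (v * q - m) w
State-mutate₀ {w} {u} {m} {v} {p} {q} S@(state hw hu hm hv hp hq M P) m≤vq =
  state (<⇒≤ hu) 0<q (<⇒≤ hv) (0<p+vw S) (i≤j⇒0≤j-i m≤vq) hw
    (trans (solve 6 (λ w u m v p q →
      `markov u q v (p :+ v :* w) (v :* q :- m) w := `markov w u m v p q) refl w u m v p q) M)
    (flip± (solve 6 (λ w u m v p q →
      `pfaffian u q v (p :+ v :* w) (v :* q :- m) w := :- `pfaffian w u m v p q) refl w u m v p q) P)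
  where
  0<q : 0ℤ < q
  0<q = ≤∧≢⇒< hq λ { refl → <⇒≱ (<-≤-trans (0<m S) m≤vq) (≤-reflexive (*-zeroʳ v)) }

State-mutate₀′ : ∀ {w u m v p q} → State w u m v p q → v * q < m →
  State q v (p + v * w) u w (m - v * q)
State-mutate₀′ {w} {u} {m} {v} {p} {q} S@(state hw hu hm hv hp hq M P) vq<m =
  state hq hv (<⇒≤ (0<p+vw S)) hu hw (i≤j⇒0≤j-i (<⇒≤ vq<m))
    (trans (solve 6 (λ w u m v p q →
      `markov q v (p :+ v :* w) u w (m :- v :* q) := `markov w u m v p q) refl w u m v p q) M)
    (subst (λ x → x ≡ + 3 ⊎ x ≡ - (+ 3)) (solve 6 (λ w u m v p q →
      `pfaffian w u m v p q := `pfaffian q v (p :+ v :* w) u w (m :- v :* q)) refl w u m v p q) P)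

State-mutate₂ : ∀ {w u m v p q} → State w u m v p q → p < u * m → v ≤ q * m →
  State w (u * m - p) m q u (q * m - v)
State-mutate₂ {w} {u} {m} {v} {p} {q} S@(state hw hu hm hv hp hq M P) p<um v≤qm =
  state hw (i<j⇒0<j-i p<um) hm 0<q (<⇒≤ hu) (i≤j⇒0≤j-i v≤qm)
    (trans (solve 6 (λ w u m v p q →
      `markov w (u :* m :- p) m q u (q :* m :- v) := `markov w u m v p q) refl w u m v p q) M)
    (subst (λ x → x ≡ + 3 ⊎ x ≡ - (+ 3)) (solve 6 (λ w u m v p q →
      `pfaffian w u m v p q := `pfaffian w (u :* m :- p) m q u (q :* m :- v)) refl w u m v p q) P)
  where
  0<q : 0ℤ < q
  0<q = ≤∧≢⇒< hq λ { refl → <⇒≱ (<-≤-trans hv v≤qm) (≤-reflexive (*-zeroˡ m)) }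

-- In the new vertex order w takes a place where a positive weight is required. For w = 0 a second
-- application of `p<um-or-exceptional`, to the state with 0 and 1 exchanged, contradicts q m < v
-- unless the state is exceptional.
State-mutate₂′ : ∀ {w u m v p q} → State w u m v p q → p < u * m → q * m < v →
  State q w (u * m - p) m (v - q * m) u ⊎ Exceptional w u m v p q
State-mutate₂′ {w} {u} {m} {v} {p} {q} S@(state hw hu hm hv hp hq M P) p<um qm<v with 0ℤ <? w
... | yes 0<w = inj₁ (state hq 0<w (i≤j⇒0≤j-i (<⇒≤ p<um)) (0<m S) (i≤j⇒0≤j-i (<⇒≤ qm<v)) (<⇒≤ hu)
    (trans (solve 6 (λ w u m v p q →
      `markov q w (u :* m :- p) m (v :- q :* m) u := `markov w u m v p q) refl w u m v p q) M)
    (flip± (solve 6 (λ w u m v p q →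
      `pfaffian q w (u :* m :- p) m (v :- q :* m) u := :- `pfaffian w u m v p q) refl w u m v p q) P))
... | no w≯0 with ≤-antisym hw (≮⇒≥ w≯0)
... | refl = dual-case (p<um-or-exceptional dual)
  where
  0<q : 0ℤ < q
  0<q = subst (0ℤ <_) (solve 2 (λ q u → q :+ u :* con 0ℤ := q) refl q u) (0<p+vw (State-mirror S))
  0<p : 0ℤ < p
  0<p = subst (0ℤ <_) (solve 2 (λ p v → p :+ v :* con 0ℤ := p) refl p v) (0<p+vw S)
  -- If w = 0, the vertices 0 and 1 can be exchanged.
  dual : State 0ℤ q m p v u
  dual = state hw 0<q hm 0<p (<⇒≤ hv) (<⇒≤ hu)
    (trans (solve 5 (λ u m v p q →
      `markov (con 0ℤ) q m p v u := `markov (con 0ℤ) u m v p q) refl u m v p q) M)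
    (flip± (solve 5 (λ u m v p q →
      `pfaffian (con 0ℤ) q m p v u := :- `pfaffian (con 0ℤ) u m v p q) refl u m v p q) P)
  dual-case : ∀ {X} → v < q * m ⊎ Exceptional 0ℤ q m p v u → X ⊎ Exceptional 0ℤ u m v p q
  dual-case (inj₁ v<qm) = ⊥-elim (<-asym v<qm qm<v)
  -- The exchange interchanges `e₁` and `e₃`; `e₂` has w = 1 and cannot occur.
  dual-case (inj₂ e₁) = inj₂ e₃
  dual-case (inj₂ e₃) = inj₂ e₁

-- Entries of mutated matrices; compatibility with relabelling and reversal.

-- A generic entry of mutate k B at i, j, for b = B i j, x = B i k and y = B k j.
through : (b x y : ℤ) → ℤ
through b x y = b + pos x * pos y - pos (- x) * pos (- y)

pos-nonneg : ∀ {x} → 0ℤ ≤ x → pos x ≡ x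
pos-nonneg = i≥j⇒i⊔j≡i

pos-nonpos : ∀ {x} → 0ℤ ≤ x → pos (- x) ≡ 0ℤ
pos-nonpos 0≤x = i≤j⇒i⊔j≡j (neg-mono-≤ 0≤x)

through-value : ∀ b {x y} {x⁺ y⁺ x⁻ y⁻} →
  pos x ≡ x⁺ → pos y ≡ y⁺ → pos (- x) ≡ x⁻ → pos (- y) ≡ y⁻ →
  through b x y ≡ b + x⁺ * y⁺ - x⁻ * y⁻
through-value b refl refl refl refl = refl

pos-neg-neg : ∀ {x} → 0ℤ ≤ x → pos (- - x) ≡ x
pos-neg-neg {x} 0≤x = trans (cong pos (neg-involutive x)) (pos-nonneg 0≤x)

-- The suffixes are the signs of the entries towards and from k; only equal signs give a path
-- through k. Negative entries come with an equation x′ ≡ - x, the form in which skew-symmetry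
-- supplies them.
through-++ : ∀ b {x y} → 0ℤ ≤ x → 0ℤ ≤ y → through b x y ≡ b + x * y
through-++ b {x} {y} 0≤x 0≤y =
  trans (through-value b (pos-nonneg 0≤x) (pos-nonneg 0≤y) (pos-nonpos 0≤x) (pos-nonpos 0≤y))
    (solve 3 (λ b x y → b :+ x :* y :- con 0ℤ :* con 0ℤ := b :+ x :* y) refl b x y)

through--- : ∀ b {x y x′ y′} → x′ ≡ - x → y′ ≡ - y → 0ℤ ≤ x → 0ℤ ≤ y →
  through b x′ y′ ≡ b - x * y
through--- b {x} {y} refl refl 0≤x 0≤y =
  trans (through-value b (pos-nonpos 0≤x) (pos-nonpos 0≤y) (pos-neg-neg 0≤x) (pos-neg-neg 0≤y))
    (solve 3 (λ b x y → b :+ con 0ℤ :* con 0ℤ :- x :* y := b :- x :* y) refl b x y)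

through--+ : ∀ b {x y x′} → x′ ≡ - x → 0ℤ ≤ x → 0ℤ ≤ y → through b x′ y ≡ b
through--+ b {x} {y} refl 0≤x 0≤y =
  trans (through-value b (pos-nonpos 0≤x) (pos-nonneg 0≤y) (pos-neg-neg 0≤x) (pos-nonpos 0≤y))
    (solve 3 (λ b x y → b :+ con 0ℤ :* y :- x :* con 0ℤ := b) refl b x y)

through-+- : ∀ b {x y y′} → y′ ≡ - y → 0ℤ ≤ x → 0ℤ ≤ y → through b x y′ ≡ b
through-+- b {x} {y} refl 0≤x 0≤y =
  trans (through-value b (pos-nonneg 0≤x) (pos-nonpos 0≤y) (pos-nonpos 0≤x) (pos-neg-neg 0≤y))
    (solve 3 (λ b x y → b :+ x :* con 0ℤ :- con 0ℤ :* y := b) refl b x y)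

through-cong : ∀ {b b′ x x′ y y′} → b ≡ b′ → x ≡ x′ → y ≡ y′ → through b x y ≡ through b′ x′ y′
through-cong refl refl refl = refl

mutate-relabel : ∀ {n} {B B′ : Mat n} (σ : Permutation′ n) →
  (∀ i j → B′ (σ ⟨$⟩ʳ i) (σ ⟨$⟩ʳ j) ≡ B i j) →
  ∀ k i j → mutate (σ ⟨$⟩ʳ k) B′ (σ ⟨$⟩ʳ i) (σ ⟨$⟩ʳ j) ≡ mutate k B i j
mutate-relabel σ eq k i j
  with (σ ⟨$⟩ʳ i) ≟F (σ ⟨$⟩ʳ k) | (σ ⟨$⟩ʳ j) ≟F (σ ⟨$⟩ʳ k) | i ≟F k | j ≟F k
... | yes _  | _      | yes _    | _        = cong -_ (eq i j)
... | no _   | yes _  | no _     | yes _    = cong -_ (eq i j)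
... | no _   | no _   | no _     | no _     = through-cong (eq i j) (eq i k) (eq k j)
... | yes σi | _      | no i≢k   | _        = ⊥-elim (i≢k (Injection.injective (↔⇒↣ σ) σi))
... | no σi  | _      | yes refl | _        = ⊥-elim (σi refl)
... | no _   | yes σj | no _     | no j≢k   = ⊥-elim (j≢k (Injection.injective (↔⇒↣ σ) σj))
... | no _   | no σj  | no _     | yes refl = ⊥-elim (σj refl)

mutate-transpose : ∀ {n} {B B′ : Mat n} → (∀ i j → B′ i j ≡ B j i) →
  ∀ k i j → mutate k B′ i j ≡ mutate k B j i
mutate-transpose {B = B} eq k i j with i ≟F k | j ≟F k
... | yes _ | yes _ = cong -_ (eq i j)
... | yes _ | no _  = cong -_ (eq i j)
... | no _  | yes _ = cong -_ (eq i j)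
... | no _  | no _  = trans (through-cong (eq i j) (eq i k) (eq k j))
  (cong₂ (λ s t → B j i + s - t) (*-comm (pos (B k i)) (pos (B j k)))
    (*-comm (pos (- B k i)) (pos (- B j k))))

mutate-skew : ∀ {n} {B : Mat n} → SkewSymmetric B → ∀ k → SkewSymmetric (mutate k B)
mutate-skew {B = B} skew k i j with i ≟F k | j ≟F k
... | yes _ | yes _ = cong -_ (skew i j)
... | yes _ | no _  = cong -_ (skew i j)
... | no _  | yes _ = cong -_ (skew i j)
... | no _  | no _  rewrite skew i j | skew i k | skew k j
  | neg-involutive (B k i) | neg-involutive (B j k) =
  solve 5 (λ b x y z t → :- b :+ x :* y :- z :* t := :- (b :+ t :* z :- y :* x)) refl
    (B j i) (pos (- B k i)) (pos (- B j k)) (pos (B k i)) (pos (B j k))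

-- The class of quivers.

record Encodes (B : Mat 4) (w u m v p q : ℤ) : Set where
  constructor encodes
  field
    skew : SkewSymmetric B
    ≡w : B 0F 1F ≡ w
    ≡u : B 1F 2F ≡ u
    ≡m : B 2F 3F ≡ m
    ≡v : B 3F 0F ≡ v
    ≡p : B 3F 1F ≡ p
    ≡q : B 0F 2F ≡ q

relabelling : (σ τ : Vec (Fin 4) 4) →
  {True (all? λ i → lookup σ (lookup τ i) ≟F i)} →
  {True (all? λ i → lookup τ (lookup σ i) ≟F i)} → Permutation′ 4
relabelling σ τ {l} {r} = permutation (lookup σ) (lookup τ) (toWitness l) (toWitness r)

relabelled : Permutation′ 4 → Mat 4 → Mat 4
relabelled σ B i j = B (σ ⟨$⟩ʳ i) (σ ⟨$⟩ʳ j)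

infix 10 _ᵀ
_ᵀ : ∀ {n} → Mat n → Mat n
(B ᵀ) i j = B j i

quiver : (b₀₁ b₀₂ b₀₃ b₁₂ b₁₃ b₂₃ : ℤ) → Mat 4
quiver b₀₁ b₀₂ b₀₃ b₁₂ b₁₃ b₂₃ i j = lookup (lookup
  ( (0ℤ    ∷ b₀₁   ∷ b₀₂   ∷ b₀₃ ∷ [])
  ∷ (- b₀₁ ∷ 0ℤ    ∷ b₁₂   ∷ b₁₃ ∷ [])
  ∷ (- b₀₂ ∷ - b₁₂ ∷ 0ℤ    ∷ b₂₃ ∷ [])
  ∷ (- b₀₃ ∷ - b₁₃ ∷ - b₂₃ ∷ 0ℤ  ∷ []) ∷ []) i) j

tournament : (w u m v p q : ℤ) → Mat 4
tournament w u m v p q = quiver w q (- v) u (- p) m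

-- Matrices are functions, so `relabel` and `transpose` ask for agreement entry by entry; with the
-- identity permutation `relabel` transports membership along pointwise equality.
data Class : Mat 4 → Set where
  seed₁     : Class BQ
  seed₂     : Class (quiver (+ 2) (+ 1) (- + 1) (+ 0) (+ 1) (- + 1))
  seed₃     : Class (quiver (+ 2) (+ 0) (- + 1) (+ 1) (+ 1) (- + 1))
  state     : ∀ {B w u m v p q} → Encodes B w u m v p q → State w u m v p q → Class B
  relabel   : ∀ {B B′} (σ : Permutation′ 4) → Class B →
              (∀ i j → relabelled σ B′ i j ≡ B i j) → Class B′
  transpose : ∀ {B B′} → Class B → (∀ i j → B′ i j ≡ B j i) → Class B′

i≡-i⇒i≡0 : ∀ {x} → x ≡ - x → x ≡ 0ℤ
i≡-i⇒i≡0 {+ 0} _ = refl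

Encodes⇒≡tournament : ∀ {B w u m v p q} → Encodes B w u m v p q →
  ∀ i j → B i j ≡ tournament w u m v p q i j
Encodes⇒≡tournament {B} (encodes sk refl refl refl refl refl refl) = λ where
  0F 0F → i≡-i⇒i≡0 (sk 0F 0F)
  0F 1F → refl
  0F 2F → refl
  0F 3F → sk 0F 3F
  1F 0F → sk 1F 0F
  1F 1F → i≡-i⇒i≡0 (sk 1F 1F)
  1F 2F → refl
  1F 3F → sk 1F 3F
  2F 0F → sk 2F 0F
  2F 1F → sk 2F 1F
  2F 2F → i≡-i⇒i≡0 (sk 2F 2F)
  2F 3F → refl
  3F 0F → sym (neg-involutive (B 3F 0F))
  3F 1F → sym (neg-involutive (B 3F 1F))
  3F 2F → sk 3F 2F
  3F 3F → i≡-i⇒i≡0 (sk 3F 3F)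

tournament-encodes : ∀ w u m v p q → Encodes (tournament w u m v p q) w u m v p q
tournament-encodes w u m v p q = encodes sk refl refl refl (neg-involutive v) (neg-involutive p) refl
  where
  sk : SkewSymmetric (tournament w u m v p q)
  sk 0F 0F = refl
  sk 0F 1F = sym (neg-involutive w)
  sk 0F 2F = sym (neg-involutive q)
  sk 0F 3F = sym (neg-involutive (- v))
  sk 1F 0F = refl
  sk 1F 1F = refl
  sk 1F 2F = sym (neg-involutive u)
  sk 1F 3F = sym (neg-involutive (- p))
  sk 2F 0F = refl
  sk 2F 1F = refl
  sk 2F 2F = refl
  sk 2F 3F = sym (neg-involutive m)
  sk 3F 0F = refl
  sk 3F 1F = refl
  sk 3F 2F = refl
  sk 3F 3F = refl

-- For closed matrices all side conditions are settled by evaluation, so a use displays just the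
-- relabelling and its inverse.
along : ∀ {B B′} → Class B → (σ τ : Vec (Fin 4) 4) →
  {l : True (all? λ i → lookup σ (lookup τ i) ≟F i)} →
  {r : True (all? λ i → lookup τ (lookup σ i) ≟F i)} →
  {True (all? λ i → all? λ j → B′ (lookup σ i) (lookup σ j) ≟ℤ B i j)} → Class B′
along c σ τ {l} {r} {eq} = relabel (relabelling σ τ {l} {r}) c (toWitness eq)

against : ∀ {B B′} → Class B → (σ τ : Vec (Fin 4) 4) →
  {l : True (all? λ i → lookup σ (lookup τ i) ≟F i)} →
  {r : True (all? λ i → lookup τ (lookup σ i) ≟F i)} →
  {True (all? λ i → all? λ j → B′ (lookup σ i) (lookup σ j) ≟ℤ B j i)} → Class B′
against c σ τ {l} {r} {eq} =
  relabel (relabelling σ τ {l} {r}) (transpose c (λ _ _ → refl)) (toWitness eq)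

-- Closure of the class under mutation.

0≤+ : ∀ {n} → 0ℤ ≤ + n
0≤+ = +≤+ ℕ.z≤n

state-e₁ : State (+ 0) (+ 1) (+ 1) (+ 1) (+ 2) (+ 2)
state-e₁ = state 0≤+ 0<1+ 0≤+ 0<1+ 0≤+ 0≤+ refl (inj₁ refl)

state-e₂ : State (+ 1) (+ 1) (+ 2) (+ 1) (+ 2) (+ 1)
state-e₂ = state 0≤+ 0<1+ 0≤+ 0<1+ 0≤+ 0≤+ refl (inj₁ refl)

exceptional-class : ∀ {w u m v p q} → Exceptional w u m v p q →
  Class (mutate 2F (tournament w u m v p q))
exceptional-class e₁ = along seed₂ (2F ∷ 0F ∷ 1F ∷ 3F ∷ []) (1F ∷ 2F ∷ 0F ∷ 3F ∷ [])
exceptional-class e₂ = along seed₃ (3F ∷ 2F ∷ 1F ∷ 0F ∷ []) (3F ∷ 2F ∷ 1F ∷ 0F ∷ [])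
exceptional-class e₃ = along seed₂ (2F ∷ 1F ∷ 0F ∷ 3F ∷ []) (2F ∷ 1F ∷ 0F ∷ 3F ∷ [])

-- Up to relabelling and reversal the three seeds mutate among themselves, with two exits to states:
-- `seed₂` at 0 leads to `e₁` and `seed₃` at 1 leads to `e₂`.
mutate-seed₁ : ∀ k → Class (mutate k BQ)
mutate-seed₁ 0F = against seed₁ (0F ∷ 1F ∷ 3F ∷ 2F ∷ []) (0F ∷ 1F ∷ 3F ∷ 2F ∷ [])
mutate-seed₁ 1F = along seed₂ (0F ∷ 3F ∷ 2F ∷ 1F ∷ []) (0F ∷ 3F ∷ 2F ∷ 1F ∷ [])
mutate-seed₁ 2F = along seed₂ (0F ∷ 1F ∷ 3F ∷ 2F ∷ []) (0F ∷ 1F ∷ 3F ∷ 2F ∷ [])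
mutate-seed₁ 3F = along seed₂ (0F ∷ 2F ∷ 1F ∷ 3F ∷ []) (0F ∷ 2F ∷ 1F ∷ 3F ∷ [])

mutate-seed₂ : ∀ k → Class (mutate k (quiver (+ 2) (+ 1) (- + 1) (+ 0) (+ 1) (- + 1)))
mutate-seed₂ 0F = along (state (tournament-encodes _ _ _ _ _ _) state-e₁)
  (1F ∷ 2F ∷ 0F ∷ 3F ∷ []) (2F ∷ 0F ∷ 1F ∷ 3F ∷ [])
mutate-seed₂ 1F = along seed₃ (1F ∷ 0F ∷ 2F ∷ 3F ∷ []) (1F ∷ 0F ∷ 2F ∷ 3F ∷ [])
mutate-seed₂ 2F = against seed₃ (1F ∷ 0F ∷ 2F ∷ 3F ∷ []) (1F ∷ 0F ∷ 2F ∷ 3F ∷ [])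
mutate-seed₂ 3F = along seed₁ (0F ∷ 1F ∷ 3F ∷ 2F ∷ []) (0F ∷ 1F ∷ 3F ∷ 2F ∷ [])

mutate-seed₃ : ∀ k → Class (mutate k (quiver (+ 2) (+ 0) (- + 1) (+ 1) (+ 1) (- + 1)))
mutate-seed₃ 0F = along seed₂ (1F ∷ 0F ∷ 2F ∷ 3F ∷ []) (1F ∷ 0F ∷ 2F ∷ 3F ∷ [])
mutate-seed₃ 1F = along (state (tournament-encodes _ _ _ _ _ _) state-e₂)
  (3F ∷ 2F ∷ 1F ∷ 0F ∷ []) (3F ∷ 2F ∷ 1F ∷ 0F ∷ [])
mutate-seed₃ 2F = against seed₂ (1F ∷ 0F ∷ 2F ∷ 3F ∷ []) (1F ∷ 0F ∷ 2F ∷ 3F ∷ [])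
mutate-seed₃ 3F = against seed₃ (2F ∷ 1F ∷ 0F ∷ 3F ∷ []) (2F ∷ 1F ∷ 0F ∷ 3F ∷ [])

relabelled-skew : ∀ {B} σ → SkewSymmetric B → SkewSymmetric (relabelled σ B)
relabelled-skew σ sk i j = sk (σ ⟨$⟩ʳ i) (σ ⟨$⟩ʳ j)

-- The vector defining σ lists the vertices in their new order, and the six equations read off the
-- weights in that order.
relabelledState : ∀ {B w u m v p q} σ → SkewSymmetric B → let C = relabelled σ B in
  C 0F 1F ≡ w → C 1F 2F ≡ u → C 2F 3F ≡ m → C 3F 0F ≡ v → C 3F 1F ≡ p → C 0F 2F ≡ q →
  State w u m v p q → Class B
relabelledState {B} σ sk ≡w ≡u ≡m ≡v ≡p ≡q S =
  relabel σ (state (encodes (relabelled-skew {B} σ sk) ≡w ≡u ≡m ≡v ≡p ≡q) S) (λ _ _ → refl)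

module _ {B : Mat 4} (sk : SkewSymmetric B)
  (S : State (B 0F 1F) (B 1F 2F) (B 2F 3F) (B 3F 0F) (B 3F 1F) (B 0F 2F)) where

  private
    0≤w = State.0≤w S
    0≤u = <⇒≤ (State.0<u S)
    0≤m = State.0≤m S
    0≤v = <⇒≤ (State.0<v S)
    0≤q = State.0≤q S

  mutate₀-class : Class (mutate 0F B)
  -- The sign of v q - m decides the direction of the arrows between 2 and 3 after the mutation, and
  -- with it the vertex order.
  mutate₀-class with B 2F 3F ≤? B 3F 0F * B 0F 2F
  ... | yes m≤vq = relabelledState
    (relabelling (1F ∷ 2F ∷ 0F ∷ 3F ∷ []) (2F ∷ 0F ∷ 1F ∷ 3F ∷ [])) (mutate-skew {B = B} sk 0F)
    (through--+ (B 1F 2F) (sk 1F 0F) 0≤w 0≤q)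
    (sym (sk 0F 2F))
    (sym (sk 3F 0F))
    (through-++ (B 3F 1F) 0≤v 0≤w)
    (trans (through-++ (B 3F 2F) 0≤v 0≤q)
      (trans (cong (_+ B 3F 0F * B 0F 2F) (sk 3F 2F)) (+-comm (- B 2F 3F) _)))
    (sym (sk 0F 1F))
    (State-mutate₀ S m≤vq)
  ... | no m≰vq = relabelledState
    (relabelling (2F ∷ 0F ∷ 3F ∷ 1F ∷ []) (1F ∷ 3F ∷ 0F ∷ 2F ∷ [])) (mutate-skew {B = B} sk 0F)
    (sym (sk 0F 2F))
    (sym (sk 3F 0F))
    (through-++ (B 3F 1F) 0≤v 0≤w)
    (through--+ (B 1F 2F) (sk 1F 0F) 0≤w 0≤q)
    (sym (sk 0F 1F))
    (trans (through--- (B 2F 3F) (sk 2F 0F) (sk 0F 3F) 0≤q 0≤v)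
      (cong (_-_ (B 2F 3F)) (*-comm (B 0F 2F) (B 3F 0F))))
    (State-mutate₀′ S (≰⇒> m≰vq))

  mutate₂-class : Class (mutate 2F B)
  mutate₂-class = by-p (p<um-or-exceptional S)
    where
    w′ : mutate 2F B 0F 1F ≡ B 0F 1F
    w′ = through-+- (B 0F 1F) (sk 2F 1F) 0≤q 0≤u

    u′ : mutate 2F B 1F 3F ≡ B 1F 2F * B 2F 3F - B 3F 1F
    u′ = trans (through-++ (B 1F 3F) 0≤u 0≤m)
      (trans (cong (_+ B 1F 2F * B 2F 3F) (sk 1F 3F)) (+-comm (- B 3F 1F) _))

    exceptional : Exceptional _ _ _ _ _ _ → Class (mutate 2F B)
    exceptional e = relabel id (exceptional-class e)
      (mutate-relabel id (Encodes⇒≡tournament (encodes sk refl refl refl refl refl refl)) 2F)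

    by-p : _ → Class (mutate 2F B)
    by-p (inj₂ e) = exceptional e
    -- The sign of q m - v decides the direction of the arrows between 0 and 3 after the mutation.
    by-p (inj₁ p<um) with B 3F 0F ≤? B 0F 2F * B 2F 3F
    ... | yes v≤qm = relabelledState
      (relabelling (0F ∷ 1F ∷ 3F ∷ 2F ∷ []) (0F ∷ 1F ∷ 3F ∷ 2F ∷ [])) (mutate-skew {B = B} sk 2F)
      w′ u′ (sym (sk 2F 3F)) (sym (sk 0F 2F)) (sym (sk 1F 2F))
      (trans (through-++ (B 0F 3F) 0≤q 0≤m)
        (trans (cong (_+ B 0F 2F * B 2F 3F) (sk 0F 3F)) (+-comm (- B 3F 0F) _)))
      (State-mutate₂ S p<um v≤qm)
    ... | no v≰qm with State-mutate₂′ S p<um (≰⇒> v≰qm)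
    ...   | inj₂ e = exceptional e
    ...   | inj₁ S′ = relabelledState
      (relabelling (2F ∷ 0F ∷ 1F ∷ 3F ∷ []) (1F ∷ 2F ∷ 0F ∷ 3F ∷ [])) (mutate-skew {B = B} sk 2F)
      (sym (sk 0F 2F)) w′ u′ (sym (sk 2F 3F))
      (trans (through--- (B 3F 0F) (sk 3F 2F) (sk 2F 0F) 0≤m 0≤q)
        (cong (_-_ (B 3F 0F)) (*-comm (B 2F 3F) (B 0F 2F))))
      (sym (sk 1F 2F))
      S′

mirror : Permutation′ 4
mirror = relabelling (1F ∷ 0F ∷ 3F ∷ 2F ∷ []) (1F ∷ 0F ∷ 3F ∷ 2F ∷ [])

-- Mutation commutes with relabelling and with reversal, so mutation at 1 or 3 becomes mutation at 0
-- or 2 of the mirror image.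
mutate-mirror : ∀ {B} k → Class (mutate k (relabelled mirror (B ᵀ))) → Class (mutate (mirror ⟨$⟩ʳ k) B)
mutate-mirror {B} k c = transpose
  (relabel mirror c (mutate-relabel {B′ = B ᵀ} mirror (λ _ _ → refl) k))
  (λ i j → sym (mutate-transpose {B = B} (λ _ _ → refl) (mirror ⟨$⟩ʳ k) j i))

mutate-state : ∀ {B w u m v p q} → Encodes B w u m v p q → State w u m v p q →
  ∀ k → Class (mutate k B)
mutate-state {B} (encodes sk refl refl refl refl refl refl) S = λ where
    0F → mutate₀-class sk S
    1F → mutate-mirror 0F (mutate₀-class {relabelled mirror (B ᵀ)} skᵀ (State-mirror S))
    2F → mutate₂-class sk S
    3F → mutate-mirror 2F (mutate₂-class {relabelled mirror (B ᵀ)} skᵀ (State-mirror S))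
  where
  skᵀ : SkewSymmetric (relabelled mirror (B ᵀ))
  skᵀ = relabelled-skew {B ᵀ} mirror (λ i j → sk j i)

mutate-class : ∀ {B} → Class B → ∀ k → Class (mutate k B)
mutate-class seed₁ k = mutate-seed₁ k
mutate-class seed₂ k = mutate-seed₂ k
mutate-class seed₃ k = mutate-seed₃ k
mutate-class (state enc S) k = mutate-state enc S k
mutate-class (relabel {B} {B′} σ c eq) k = relabel σ (mutate-class c (σ ⟨$⟩ˡ k)) λ i j →
  subst (λ k′ → mutate k′ B′ (σ ⟨$⟩ʳ i) (σ ⟨$⟩ʳ j) ≡ mutate (σ ⟨$⟩ˡ k) B i j) (inverseʳ σ)
    (mutate-relabel σ eq (σ ⟨$⟩ˡ k) i j)
mutate-class (transpose {B} {B′} c eq) k = transpose (mutate-class c k) (mutate-transpose eq k)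

mutateSeq-class : ∀ {B} ks → Class B → Class (mutateSeq ks B)
mutateSeq-class []       c = c
mutateSeq-class (k ∷ ks) c = mutateSeq-class ks (mutate-class c k)

-- Oriented cycles in every member of the class.

data ShortCycle (B : Mat 4) : Set where
  triangle : ∀ i j k → 0ℤ < B i j → 0ℤ < B j k → 0ℤ < B k i → ShortCycle B
  square   : ∀ i j k l → 0ℤ < B i j → 0ℤ < B j k → 0ℤ < B k l → 0ℤ < B l i → ShortCycle B

-- A state with p > 0 contains the triangle 1 → 2 → 3 → 1. For p = 0, positivity of p + v w forces w
-- > 0, and 0 → 1 → 2 → 3 → 0 is oriented.
shortCycle : ∀ {B} → Class B → ShortCycle B
shortCycle seed₁ = triangle 1F 3F 2F 0<1+ 0<1+ 0<1+
shortCycle seed₂ = triangle 0F 1F 3F 0<1+ 0<1+ 0<1+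
shortCycle seed₃ = triangle 0F 1F 3F 0<1+ 0<1+ 0<1+
shortCycle {B} (state (encodes _ refl refl refl refl refl refl) S) with 0ℤ <? B 3F 1F
... | yes 0<p = triangle 1F 2F 3F (State.0<u S) (0<m S) 0<p
... | no p≯0 = square 0F 1F 2F 3F 0<w (State.0<u S) (0<m S) (State.0<v S)
  where
  0<w : 0ℤ < B 0F 1F
  0<w = ≤∧≢⇒< (State.0≤w S) λ 0≡w → p≯0 (subst (0ℤ <_)
    (trans (cong (λ w → B 3F 1F + B 3F 0F * w) (sym 0≡w))
      (solve 2 (λ p v → p :+ v :* con 0ℤ := p) refl (B 3F 1F) (B 3F 0F)))
    (0<p+vw S))
shortCycle (relabel σ c eq) with shortCycle c
... | triangle i j k ij jk ki = triangle _ _ _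
  (subst (0ℤ <_) (sym (eq i j)) ij) (subst (0ℤ <_) (sym (eq j k)) jk)
  (subst (0ℤ <_) (sym (eq k i)) ki)
... | square i j k l ij jk kl li = square _ _ _ _
  (subst (0ℤ <_) (sym (eq i j)) ij) (subst (0ℤ <_) (sym (eq j k)) jk)
  (subst (0ℤ <_) (sym (eq k l)) kl) (subst (0ℤ <_) (sym (eq l i)) li)
shortCycle (transpose c eq) with shortCycle c
... | triangle i j k ij jk ki = triangle k j i
  (subst (0ℤ <_) (sym (eq k j)) jk) (subst (0ℤ <_) (sym (eq j i)) ij)
  (subst (0ℤ <_) (sym (eq i k)) ki)
... | square i j k l ij jk kl li = square l k j i
  (subst (0ℤ <_) (sym (eq l k)) kl) (subst (0ℤ <_) (sym (eq k j)) jk)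
  (subst (0ℤ <_) (sym (eq j i)) ij) (subst (0ℤ <_) (sym (eq i l)) li)

shortCycle⇒orientedCycle : ∀ {B} → ShortCycle B → HasOrientedCycle B
shortCycle⇒orientedCycle (triangle i j k ij jk ki) =
  -- The numeral is one less than the length of the cycle.
  2 , lookup (i ∷ j ∷ k ∷ []) , λ { 0F → ij ; 1F → jk ; 2F → ki }
shortCycle⇒orientedCycle (square i j k l ij jk kl li) =
  3 , lookup (i ∷ j ∷ k ∷ l ∷ []) , λ { 0F → ij ; 1F → jk ; 2F → kl ; 3F → li }

notMutationAcyclic : ¬ MutationAcyclic BQ
notMutationAcyclic (ks , acyclic) =
  acyclic (shortCycle⇒orientedCycle (shortCycle (mutateSeq-class ks seed₁)))

theorem4p11 : ¬ HasAdmissibleQuasiCartanCompanion BQ × ¬ MutationAcyclic BQ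
theorem4p11 = noCompanion , notMutationAcyclic
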